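{- Let $\Delta\geq 4$ be an integer and let $G$ be a finite simple graph of maximum degree at most $\Delta$ and girth at least $5$. Then \[ \nu_{ur}(G) \geq \frac{n(G)-c(G)}{\Delta}. \]
   Context: All graphs are simple, finite and undirected. The girth of $G$ is the minimum length of a cycle in $G$ (infinite if $G$ has no cycle). A matching in $G$ is a set of pairwise non-adjacent edges. A matching $M$ in $G$ is uniquely restricted if no other matching in $G$ covers exactly the same set of vertices as $M$. $\nu_{ur}(G)$ denotes the maximum size of a uniquely restricted matching in $G$. $n(G)$ and $c(G)$ denote the number of vertices and the number of connected components of $G$, respectively. -}

module Defs where

open import Data.Nat using (ℕ; zero; suc; _≤_; _<ᵇ_)
open import Data.Bool using (Bool; true; false; if_then_else_; _∧_)
open import Data.Fin using (Fin; toℕ; inject₁; fromℕ)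
open import Data.List using (map; allFin)
open import Data.Nat.ListAction using (sum)
open import Data.Product using (Σ; ∃; _×_)
open import Function.Definitions using (Injective; Surjective)
open import Relation.Binary.PropositionalEquality using (_≡_)
open import Relation.Binary.Construct.Closure.ReflexiveTransitive using (Star)
open import Function.Bundles using (_⇔_)

record Graph (n : ℕ) : Set where
  field
    adj   : Fin n → Fin n → Bool
    irrefl : ∀ v → adj v v ≡ false
    sym   : ∀ u v → adj u v ≡ adj v u
open Graph public

countV : ∀ {n} → (Fin n → Bool) → ℕ
countV {n} p = sum (map (λ v → if p v then 1 else 0) (allFin n))

degree : ∀ {n} → Graph n → Fin n → ℕ
degree G v = countV (adj G v)

MaxDegreeAtMost : ∀ {n} → Graph n → ℕ → Set
MaxDegreeAtMost G Δ = ∀ v → degree G v ≤ Δ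

IsCycle : ∀ {n} → Graph n → (k : ℕ) → (Fin (suc k) → Fin n) → Set
IsCycle G k f =
  (3 ≤ suc k) × Injective _≡_ _≡_ f
    × (∀ (i : Fin k) → adj G (f (inject₁ i)) (f (Fin.suc i)) ≡ true)
    × (adj G (f (fromℕ k)) (f Fin.zero) ≡ true)

GirthAtLeast : ∀ {n} → Graph n → ℕ → Set
GirthAtLeast {n} G g = ∀ k (f : Fin (suc k) → Fin n) → IsCycle G k f → g ≤ suc k

Reachable : ∀ {n} → Graph n → Fin n → Fin n → Set
Reachable G = Star (λ u v → adj G u v ≡ true)

HasComponents : ∀ {n} → Graph n → ℕ → Set
HasComponents {n} G c =
  Σ (Fin n → Fin c) λ comp →
    Surjective _≡_ _≡_ comp × (∀ u v → (comp u ≡ comp v) ⇔ Reachable G u v)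

-- A set of edges, given by a Boolean indicator on ordered pairs
-- (required symmetric).
EdgeSet : ℕ → Set
EdgeSet n = Fin n → Fin n → Bool

IsMatching : ∀ {n} → Graph n → EdgeSet n → Set
IsMatching G M =
  (∀ u v → M u v ≡ true → adj G u v ≡ true)
  × (∀ u v → M u v ≡ M v u)
  × (∀ u v w → M u v ≡ true → M u w ≡ true → v ≡ w)

Covers : ∀ {n} → EdgeSet n → Fin n → Set
Covers M v = ∃ λ w → M v w ≡ true

-- number of edges of M (each unordered edge {u,v} counted once, via u < v)
size : ∀ {n} → EdgeSet n → ℕ
size {n} M = sum (map (λ u → countV (λ v → (toℕ u <ᵇ toℕ v) ∧ M u v)) (allFin n))

IsUniquelyRestricted : ∀ {n} → Graph n → EdgeSet n → Set
IsUniquelyRestricted {n} G M =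
  IsMatching G M ×
  (∀ M' → IsMatching G M' → (∀ v → Covers M' v ⇔ Covers M v) →
     ∀ u v → M' u v ≡ M u v)

{-# OPTIONS --safe #-}
module Submission where

-- Process an alive vertex set W, starting from all of V: repeatedly pick an
-- alive vertex a with an alive neighbour b, add ab to the matching and delete
-- N[a] from W.  Since a has no neighbour among the vertices matched later, ab is
-- forced in every matching covering the same vertices, so the result is uniquely
-- restricted.  The choice of a makes each step pay for at most Δ vertices that
-- are not the chosen root of their component:
--   * Vertices of alive degree at most 1 are peeled off first.  If B is the set
--     of deleted neighbours and L the rest of what is peeled, then L has all its
--     neighbours in B, so charging every nonroot of B ∪ L to its parent edge in
--     a spanning forest gives at most Δ |B| nonroots, for |B| matching edges.
--   * When all degrees are at least 3, deleting N[a] leaves minimum degree at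
--     least 2, because a vertex outside N[a] has at most one neighbour in N(a)
--     (there is no 4-cycle).  If some a has degree below Δ, this costs at most Δ
--     vertices.  Otherwise W is a union of components of G, and a can be taken
--     to be a root.
--   * When a has degree 2, delete N[a] and peel again.  A vertex of L has degree
--     at least 2 and at most one neighbour in N(a), so counting the edges from L
--     to B and to N(a) gives |L| ≤ Δ |B| and 2 |L| ≤ 2 (Δ - 1) + Δ |B|, whence
--     3 + |B| + |L| ≤ Δ (1 + |B|).  This is where Δ ≥ 4 is needed.

open import Defs
open import Data.Nat using (ℕ; _≤_; _*_; _∸_)
open import Data.Product using (Σ; _×_)
open import Data.Nat using (zero; suc; _+_; _<_; z≤n; s≤s; _<ᵇ_; _≤?_; _<?_)
open import Data.Nat.Properties hiding (_≟_)
open import Data.Nat.Tactic.RingSolver using (solve-∀)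
open import Data.Bool using (Bool; true; false; not; _∧_; _∨_; if_then_else_)
open import Data.Bool.Properties using (∧-conicalˡ; ∧-conicalʳ; T-≡) renaming (_≟_ to _≟ᵇ_)
open import Data.Fin using (Fin; zero; suc; toℕ; inject₁; _≟_)
open import Data.Fin.Properties using (any?; toℕ-injective)
open import Data.List using (map; allFin; tabulate)
open import Data.List.Properties using (map-tabulate)
import Data.Nat.ListAction as List
open import Data.Product using (∃; _,_; proj₁; proj₂)
open import Data.Sum using (_⊎_; inj₁; inj₂; [_,_]′)
open import Data.Empty using (⊥; ⊥-elim)
open import Function using (_∘_; id)
open import Function.Bundles using (_⇔_; mk⇔; Equivalence)
open import Relation.Nullary using (Dec; yes; no; does; contradiction)
open import Relation.Nullary.Decidable using (_×-dec_; dec-true)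
open import Relation.Unary using (Decidable)
open import Relation.Binary using (tri<; tri≈; tri>)
open import Relation.Binary.PropositionalEquality using (_≡_; _≢_; refl; trans; cong; cong₂; subst; module ≡-Reasoning) renaming (sym to ≡-sym)
open import Relation.Binary.Construct.Closure.ReflexiveTransitive using (ε; _◅_)
open import Algebra.Properties.Semiring.Sum +-*-semiring using (sum; sum-cong-≗; sum-replicate-zero; ∑-distrib-+; ∑-comm; *-distribˡ-sum)

open Equivalence using (to; from)

private
  variable
    n : ℕ

-- Indicators and finite sums

𝟙 : Bool → ℕ
𝟙 b = if b then 1 else 0

infix 4 _==_

_==_ : Fin n → Fin n → Bool
u == v = does (u ≟ v)

∣_∣ : (Fin n → Bool) → ℕ
∣ p ∣ = sum (𝟙 ∘ p)

==-refl : (v : Fin n) → (v == v) ≡ true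
==-refl v = dec-true (v ≟ v) refl

==⇒≡ : {u v : Fin n} → (u == v) ≡ true → u ≡ v
==⇒≡ {u = u} {v} e with yes p ← u ≟ v = p

true-cases : (b : Bool) → b ≡ true ⊎ b ≡ false
true-cases true = inj₁ refl
true-cases false = inj₂ refl

true≢false : {b : Bool} → b ≡ true → b ≢ false
true≢false refl ()

⇔⇒≡ : {x y : Bool} → (x ≡ true → y ≡ true) → (y ≡ true → x ≡ true) → x ≡ y
⇔⇒≡ {true} f g = ≡-sym (f refl)
⇔⇒≡ {false} {true} f g = g refl
⇔⇒≡ {false} {false} f g = refl

∧-intro : {x y : Bool} → x ≡ true → y ≡ true → x ∧ y ≡ true
∧-intro refl refl = refl

∨-introˡ : {x y : Bool} → x ≡ true → x ∨ y ≡ true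
∨-introˡ refl = refl

∨-introʳ : (x : Bool) {y : Bool} → y ≡ true → x ∨ y ≡ true
∨-introʳ true refl = refl
∨-introʳ false refl = refl

∨-elim : (x : Bool) {y : Bool} → x ∨ y ≡ true → x ≡ true ⊎ y ≡ true
∨-elim true _ = inj₁ refl
∨-elim false e = inj₂ e

𝟙-true : {b : Bool} → b ≡ true → 1 ≤ 𝟙 b
𝟙-true refl = ≤-refl

𝟙-bound : {b : Bool} {k : ℕ} → (b ≡ true → 1 ≤ k) → 𝟙 b ≤ k
𝟙-bound {true} h = h refl
𝟙-bound {false} h = z≤n

𝟙-mono : {b c : Bool} → (b ≡ true → c ≡ true) → 𝟙 b ≤ 𝟙 c
𝟙-mono h = 𝟙-bound (𝟙-true ∘ h)

sum-ones : ∀ n → sum {n} (λ _ → 1) ≡ n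
sum-ones zero = refl
sum-ones (suc n) = cong suc (sum-ones n)

sum-mono-≤ : {f g : Fin n → ℕ} → (∀ i → f i ≤ g i) → sum f ≤ sum g
sum-mono-≤ {zero} h = z≤n
sum-mono-≤ {suc n} h = +-mono-≤ (h zero) (sum-mono-≤ (h ∘ suc))

∣∣-mono : {p q : Fin n → Bool} → (∀ v → p v ≡ true → q v ≡ true) → ∣ p ∣ ≤ ∣ q ∣
∣∣-mono h = sum-mono-≤ λ v → 𝟙-mono (h v)

∣singleton∣ : (a : Fin n) → ∣ _== a ∣ ≡ 1
∣singleton∣ {suc n} zero = cong suc (sum-replicate-zero n)
∣singleton∣ {suc n} (suc a) = ∣singleton∣ a

-- Turns a vertex indicator into a count of pairs with one marked partner, so that counting vertices
-- can become counting pairs, as in `charge`.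
∣∧-singleton∣ : (c : Bool) (a : Fin n) → sum (λ v → 𝟙 (c ∧ (v == a))) ≡ 𝟙 c
∣∧-singleton∣ true a = ∣singleton∣ a
∣∧-singleton∣ {n} false a = sum-replicate-zero n

∣∣≥1 : {p : Fin n → Bool} {v : Fin n} → p v ≡ true → 1 ≤ ∣ p ∣
∣∣≥1 {p = p} {v} pv = ≤-trans (≤-reflexive (≡-sym (∣singleton∣ v)))
  (∣∣-mono {p = _== v} {p} λ u e → subst (λ x → p x ≡ true) (≡-sym (==⇒≡ {u = u} e)) pv)

∣∣≤0 : {p : Fin n → Bool} → (∀ v → p v ≢ true) → ∣ p ∣ ≤ 0
∣∣≤0 {n} h = ≤-trans (sum-mono-≤ λ v → 𝟙-bound λ e → ⊥-elim (h v e)) (≤-reflexive (sum-replicate-zero n))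

∣∣≥1⇒∃ : (p : Fin n → Bool) → 1 ≤ ∣ p ∣ → ∃ λ v → p v ≡ true
∣∣≥1⇒∃ p h with any? (λ v → p v ≟ᵇ true)
... | yes e = e
... | no ¬e = contradiction (≤-trans h (∣∣≤0 λ v e → ¬e (v , e))) λ ()

∣∣≤1 : {p : Fin n → Bool} → (∀ u v → p u ≡ true → p v ≡ true → u ≡ v) → ∣ p ∣ ≤ 1
∣∣≤1 {p = p} h with any? (λ v → p v ≟ᵇ true)
... | no ¬e = m≤n⇒m≤1+n (∣∣≤0 λ v e → ¬e (v , e))
... | yes (a , pa) = ≤-trans (∣∣-mono λ v pv → trans (cong (_== a) (h v a pv pa)) (==-refl a)) (≤-reflexive (∣singleton∣ a))

∣∣-insert : {p q : Fin n → Bool} {a : Fin n} → p a ≢ true → q a ≡ true → (∀ v → p v ≡ true → q v ≡ true) → suc ∣ p ∣ ≤ ∣ q ∣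
∣∣-insert {p = p} {q} {a} pa qa p⊆q = begin
  1 + ∣ p ∣                            ≡⟨ cong (_+ ∣ p ∣) (≡-sym (∣singleton∣ a)) ⟩
  ∣ _== a ∣ + ∣ p ∣                    ≡⟨ ≡-sym (∑-distrib-+ (𝟙 ∘ (_== a)) (𝟙 ∘ p)) ⟩
  sum (λ v → 𝟙 (v == a) + 𝟙 (p v))     ≤⟨ sum-mono-≤ bound ⟩
  ∣ q ∣                                ∎
  where
  open ≤-Reasoning
  bound : ∀ v → 𝟙 (v == a) + 𝟙 (p v) ≤ 𝟙 (q v)
  bound v with v ≟ a
  ... | no _ = 𝟙-mono (p⊆q v)
  ... | yes refl = begin
    1 + 𝟙 (p v)  ≤⟨ s≤s (𝟙-bound {p v} {0} (⊥-elim ∘ pa)) ⟩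
    1            ≤⟨ 𝟙-true qa ⟩
    𝟙 (q v)      ∎

∣∣-cover : {p : Fin n → Bool} (q r : Fin n → Bool) → (∀ v → p v ≡ true → q v ≡ true ⊎ r v ≡ true) → ∣ p ∣ ≤ ∣ q ∣ + ∣ r ∣
∣∣-cover {p = p} q r h = ≤-trans (sum-mono-≤ bound) (≤-reflexive (∑-distrib-+ (𝟙 ∘ q) (𝟙 ∘ r)))
  where
  bound : ∀ v → 𝟙 (p v) ≤ 𝟙 (q v) + 𝟙 (r v)
  bound v = 𝟙-bound {p v} λ e → [ (λ qv → ≤-trans (𝟙-true qv) (m≤m+n (𝟙 (q v)) (𝟙 (r v)))) , (λ rv → ≤-trans (𝟙-true rv) (m≤n+m (𝟙 (r v)) (𝟙 (q v)))) ]′ (h v e)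

weighted≤ : {f : Fin n → ℕ} {k : ℕ} (S : Fin n → Bool) → (∀ v → S v ≡ true → f v ≤ k) → sum (λ v → 𝟙 (S v) * f v) ≤ k * ∣ S ∣
weighted≤ {f = f} {k} S h = ≤-trans (sum-mono-≤ bound) (≤-reflexive (≡-sym (*-distribˡ-sum k (𝟙 ∘ S))))
  where
  bound : ∀ v → 𝟙 (S v) * f v ≤ k * 𝟙 (S v)
  bound v with S v | h v
  ... | true | hv = ≤-trans (≤-reflexive (+-identityʳ (f v))) (≤-trans (hv refl) (≤-reflexive (≡-sym (*-identityʳ k))))
  ... | false | _ = z≤n

weighted≥ : {f : Fin n → ℕ} {k : ℕ} (S : Fin n → Bool) → (∀ v → S v ≡ true → k ≤ f v) → k * ∣ S ∣ ≤ sum (λ v → 𝟙 (S v) * f v)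
weighted≥ {f = f} {k} S h = ≤-trans (≤-reflexive (*-distribˡ-sum k (𝟙 ∘ S))) (sum-mono-≤ bound)
  where
  bound : ∀ v → k * 𝟙 (S v) ≤ 𝟙 (S v) * f v
  bound v with S v | h v
  ... | true | hv = ≤-trans (≤-reflexive (*-identityʳ k)) (≤-trans (hv refl) (≤-reflexive (≡-sym (+-identityʳ (f v)))))
  ... | false | _ = ≤-reflexive (*-zeroʳ k)

-- Here `j` and `ℓ` stand for `∣ B ∣` and `∣ L ∣`. The first bound on `ℓ` settles `j ≤ 1`. For
-- `j ≥ 2` the claim is doubled: after the second bound the left side still has `2 * j + 4`, which
-- is at most `4 * j` and hence at most `Δ * j`.
2-edge-count : ∀ Δ j ℓ → 4 ≤ Δ → ℓ ≤ Δ * j → 2 * ℓ + 2 ≤ Δ * 2 + Δ * j → 3 + (j + ℓ) ≤ Δ + Δ * j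
2-edge-count Δ zero ℓ 4≤Δ h _ = begin
  3 + ℓ        ≤⟨ +-mono-≤ (≤-trans (n≤1+n 3) 4≤Δ) h ⟩
  Δ + Δ * 0    ∎
  where open ≤-Reasoning
2-edge-count Δ (suc zero) ℓ 4≤Δ h _ = +-mono-≤ 4≤Δ h
2-edge-count Δ (suc (suc i)) ℓ 4≤Δ _ h = *-cancelˡ-≤ 2 (begin
  2 * (3 + (2 + i + ℓ))                       ≡⟨ solve₁ ℓ i ⟩
  2 * ℓ + 2 + (8 + 2 * i)                     ≤⟨ +-mono-≤ h (+-monoʳ-≤ 8 (*-monoˡ-≤ i (s≤s (s≤s (z≤n {2}))))) ⟩
  Δ * 2 + Δ * (2 + i) + (8 + 4 * i)           ≡⟨ cong (Δ * 2 + Δ * (2 + i) +_) (solve₂ i) ⟩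
  Δ * 2 + Δ * (2 + i) + 4 * (2 + i)           ≤⟨ +-monoʳ-≤ (Δ * 2 + Δ * (2 + i)) (*-monoˡ-≤ (2 + i) 4≤Δ) ⟩
  Δ * 2 + Δ * (2 + i) + Δ * (2 + i)           ≡⟨ solve₃ Δ i ⟩
  2 * (Δ + Δ * (2 + i))                       ∎)
  where
  open ≤-Reasoning
  solve₁ : ∀ ℓ i → 2 * (3 + (2 + i + ℓ)) ≡ 2 * ℓ + 2 + (8 + 2 * i)
  solve₁ = solve-∀
  solve₂ : ∀ i → 8 + 4 * i ≡ 4 * (2 + i)
  solve₂ = solve-∀
  solve₃ : ∀ Δ i → Δ * 2 + Δ * (2 + i) + Δ * (2 + i) ≡ 2 * (Δ + Δ * (2 + i))
  solve₃ = solve-∀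

-- From counts over lists to finite sums

sum-tabulate : (f : Fin n → ℕ) → List.sum (tabulate f) ≡ sum f
sum-tabulate {zero} f = refl
sum-tabulate {suc n} f = cong (f zero +_) (sum-tabulate (f ∘ suc))

sum-allFin : (f : Fin n → ℕ) → List.sum (map f (allFin n)) ≡ sum f
sum-allFin f = trans (cong List.sum (map-tabulate id f)) (sum-tabulate f)

countV≡∣∣ : (p : Fin n → Bool) → countV p ≡ ∣ p ∣
countV≡∣∣ p = sum-allFin (𝟙 ∘ p)

size≡sum : (M : EdgeSet n) → size M ≡ sum (λ u → ∣ (λ v → (toℕ u <ᵇ toℕ v) ∧ M u v) ∣)
size≡sum M = trans (sum-allFin (countV ∘ edge)) (sum-cong-≗ (countV≡∣∣ ∘ edge))
  where
  edge : EdgeSet _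
  edge u v = (toℕ u <ᵇ toℕ v) ∧ M u v

-- Uniquely restricted matchings inside a vertex set

module _ (G : Graph n) where

  -- Uniqueness is tested against all matchings of `G`. The support condition is what keeps these
  -- edges away from vertices deleted earlier.
  Good : (Fin n → Bool) → ℕ → Set
  Good W k = Σ (EdgeSet n) λ M → IsUniquelyRestricted G M × (∀ u v → M u v ≡ true → W u ≡ true) × k ≤ size M

  good-∅ : (W : Fin n → Bool) → Good W 0
  good-∅ W = ∅ , (((λ _ _ ()) , (λ _ _ → refl) , (λ _ _ _ ()))
               , λ N N-m cov u v → ⇔⇒≡ (λ e → contradiction (proj₂ (to (cov u) (v , e))) λ ()) (λ ()))
           , (λ _ _ ()) , z≤n
    where
    ∅ : EdgeSet n
    ∅ _ _ = false

  good-mono : {W W′ : Fin n → Bool} {k : ℕ} → (∀ v → W′ v ≡ true → W v ≡ true) → Good W′ k → Good W k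
  good-mono h (M , ur , supp , sz) = M , ur , (λ u v e → h u (supp u v e)) , sz

  adj-sym : ∀ {u v} → adj G u v ≡ true → adj G v u ≡ true
  adj-sym {u} {v} e = trans (Graph.sym G v u) e

  adj⇒≢ : ∀ {u v} → adj G u v ≡ true → u ≢ v
  adj⇒≢ {u} e refl = true≢false e (irrefl G u)

  pair : Fin n → Fin n → EdgeSet n
  pair a b u v = ((u == a) ∧ (v == b)) ∨ ((u == b) ∧ (v == a))

  pair⇒ : ∀ {a b u v} → pair a b u v ≡ true → (u ≡ a × v ≡ b) ⊎ (u ≡ b × v ≡ a)
  pair⇒ {a} {b} {u} {v} e with ∨-elim ((u == a) ∧ (v == b)) e
  ... | inj₁ p = inj₁ (==⇒≡ (∧-conicalˡ _ _ p) , ==⇒≡ (∧-conicalʳ _ _ p))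
  ... | inj₂ p = inj₂ (==⇒≡ (∧-conicalˡ _ _ p) , ==⇒≡ (∧-conicalʳ _ _ p))

  pair-ab : ∀ a b → pair a b a b ≡ true
  pair-ab a b = ∨-introˡ (∧-intro (==-refl a) (==-refl b))

  pair-ba : ∀ a b → pair a b b a ≡ true
  pair-ba a b = ∨-introʳ ((b == a) ∧ (a == b)) (∧-intro (==-refl b) (==-refl a))

  module AddEdge {a b : Fin n} (ab : adj G a b ≡ true) (M : EdgeSet n)
                 (ur : IsUniquelyRestricted G M)
                 (a∉ : ∀ v → M a v ≢ true)
                 (N[a]∉ : ∀ u v → M u v ≡ true → adj G a u ≡ false) where

    M⁺ : EdgeSet n
    M⁺ u v = M u v ∨ pair a b u v

    M-sym : ∀ {u v} → M u v ≡ true → M v u ≡ true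
    M-sym {u} {v} e = trans (proj₁ (proj₂ (proj₁ ur)) v u) e

    b∉ : ∀ v → M b v ≢ true
    b∉ v e = true≢false ab (N[a]∉ b v e)

    M⁺⇒ : ∀ {u v} → M⁺ u v ≡ true → M u v ≡ true ⊎ ((u ≡ a × v ≡ b) ⊎ (u ≡ b × v ≡ a))
    M⁺⇒ {u} {v} e with ∨-elim (M u v) e
    ... | inj₁ p = inj₁ p
    ... | inj₂ p = inj₂ (pair⇒ {v = v} p)

    M⇒M⁺ : ∀ {u v} → M u v ≡ true → M⁺ u v ≡ true
    M⇒M⁺ = ∨-introˡ

    M⁺ab : M⁺ a b ≡ true
    M⁺ab = ∨-introʳ (M a b) (pair-ab a b)

    M⁺ba : M⁺ b a ≡ true
    M⁺ba = ∨-introʳ (M b a) (pair-ba a b)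

    M⁺-sym : ∀ {u v} → M⁺ u v ≡ true → M⁺ v u ≡ true
    M⁺-sym e with M⁺⇒ e
    ... | inj₁ p = M⇒M⁺ (M-sym p)
    ... | inj₂ (inj₁ (refl , refl)) = M⁺ba
    ... | inj₂ (inj₂ (refl , refl)) = M⁺ab

    M⁺-matching : IsMatching G M⁺
    M⁺-matching = edges , (λ u v → ⇔⇒≡ M⁺-sym M⁺-sym) , unique
      where
      edges : ∀ u v → M⁺ u v ≡ true → adj G u v ≡ true
      edges u v e with M⁺⇒ e
      ... | inj₁ p = proj₁ (proj₁ ur) u v p
      ... | inj₂ (inj₁ (refl , refl)) = ab
      ... | inj₂ (inj₂ (refl , refl)) = adj-sym ab
      unique : ∀ u v w → M⁺ u v ≡ true → M⁺ u w ≡ true → v ≡ w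
      unique u v w e f with M⁺⇒ e | M⁺⇒ f
      ... | inj₁ p | inj₁ q = proj₂ (proj₂ (proj₁ ur)) u v w p q
      ... | inj₁ p | inj₂ (inj₁ (refl , refl)) = ⊥-elim (a∉ v p)
      ... | inj₁ p | inj₂ (inj₂ (refl , refl)) = ⊥-elim (b∉ v p)
      ... | inj₂ (inj₁ (refl , refl)) | inj₁ q = ⊥-elim (a∉ w q)
      ... | inj₂ (inj₂ (refl , refl)) | inj₁ q = ⊥-elim (b∉ w q)
      ... | inj₂ (inj₁ (refl , refl)) | inj₂ (inj₁ (refl , refl)) = refl
      ... | inj₂ (inj₂ (refl , refl)) | inj₂ (inj₂ (refl , refl)) = refl
      ... | inj₂ (inj₁ (refl , refl)) | inj₂ (inj₂ (p , refl)) = ≡-sym p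
      ... | inj₂ (inj₂ (refl , refl)) | inj₂ (inj₁ (p , refl)) = ≡-sym p

    module _ (N : EdgeSet n) (N-m : IsMatching G N) (cov : ∀ v → Covers N v ⇔ Covers M⁺ v) where

      N-sym : ∀ {u v} → N u v ≡ true → N v u ≡ true
      N-sym {u} {v} e = trans (proj₁ (proj₂ N-m) v u) e

      -- The partner `w` of `a` is covered by `N`, hence by `M⁺`. It is not covered by `M`, since it
      -- is adjacent to `a`, and it is not `a`, so only `b` remains.
      N-a : ∀ w → N a w ≡ true → w ≡ b
      N-a w e with to (cov w) (a , N-sym e)
      ... | z , f with M⁺⇒ f
      ...   | inj₁ p = ⊥-elim (true≢false (proj₁ N-m a w e) (N[a]∉ w z p))
      ...   | inj₂ (inj₁ (refl , _)) = ⊥-elim (adj⇒≢ (proj₁ N-m a a e) refl)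
      ...   | inj₂ (inj₂ (q , _)) = q

      Nab : N a b ≡ true
      Nab with from (cov a) (b , M⁺ab)
      ... | w , e = subst (λ x → N a x ≡ true) (N-a w e) e

      N-b : ∀ w → N b w ≡ true → w ≡ a
      N-b w e = proj₂ (proj₂ N-m) b w a e (N-sym Nab)

      N⁻ : EdgeSet n
      N⁻ u v = N u v ∧ not (pair a b u v)

      N⁻⇒N : ∀ {u v} → N⁻ u v ≡ true → N u v ≡ true
      N⁻⇒N = ∧-conicalˡ _ _

      -- `N` matches `a` and `b` to each other, so removing that edge leaves both uncovered.
      N⁻⇒≢ : ∀ {u v} → N⁻ u v ≡ true → u ≢ a × u ≢ b
      N⁻⇒≢ {u} {v} e = (λ { refl → absurd (∨-introˡ (∧-intro (==-refl a) (trans (cong (_== b) (N-a v (N⁻⇒N e))) (==-refl b)))) })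
                     , (λ { refl → absurd (∨-introʳ ((b == a) ∧ (v == b)) (∧-intro (==-refl b) (trans (cong (_== a) (N-b v (N⁻⇒N e))) (==-refl a)))) })
        where
        absurd : pair a b u v ≢ true
        absurd p = contradiction (trans (≡-sym (∧-conicalʳ (N u v) _ e)) (cong not p)) λ ()

      N⇒N⁻ : ∀ {u v} → N u v ≡ true → u ≢ a → u ≢ b → N⁻ u v ≡ true
      N⇒N⁻ {u} {v} e ≢a ≢b with true-cases (pair a b u v)
      ... | inj₂ p = ∧-intro e (cong not p)
      ... | inj₁ p with pair⇒ {v = v} p
      ...   | inj₁ (q , _) = ⊥-elim (≢a q)
      ...   | inj₂ (q , _) = ⊥-elim (≢b q)

      N⁻-sym : ∀ {u v} → N⁻ u v ≡ true → N⁻ v u ≡ true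
      N⁻-sym {u} {v} e = N⇒N⁻ (N-sym (N⁻⇒N e))
        (λ { refl → proj₂ (N⁻⇒≢ e) (N-a u (N-sym (N⁻⇒N e))) })
        (λ { refl → proj₁ (N⁻⇒≢ e) (N-b u (N-sym (N⁻⇒N e))) })

      N⁻-matching : IsMatching G N⁻
      N⁻-matching = (λ u v e → proj₁ N-m u v (N⁻⇒N e)) , (λ u v → ⇔⇒≡ N⁻-sym N⁻-sym)
                  , (λ u v w e f → proj₂ (proj₂ N-m) u v w (N⁻⇒N e) (N⁻⇒N f))

      N⁻-covers : ∀ v → Covers N⁻ v ⇔ Covers M v
      N⁻-covers v = mk⇔ there back
        where
        there : Covers N⁻ v → Covers M v
        there (w , e) with to (cov v) (w , N⁻⇒N e)
        ... | z , f with M⁺⇒ f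
        ...   | inj₁ p = z , p
        ...   | inj₂ (inj₁ (q , _)) = ⊥-elim (proj₁ (N⁻⇒≢ e) q)
        ...   | inj₂ (inj₂ (q , _)) = ⊥-elim (proj₂ (N⁻⇒≢ e) q)
        back : Covers M v → Covers N⁻ v
        back (w , e) with from (cov v) (w , M⇒M⁺ e)
        ... | z , f = z , N⇒N⁻ f (λ { refl → a∉ w e }) (λ { refl → b∉ w e })

      N⁻≡M : ∀ u v → N⁻ u v ≡ M u v
      -- With `ab` forced, what remains of `N` covers the same vertices as `M`, so the uniqueness of
      -- `M` applies.
      N⁻≡M = proj₂ ur N⁻ N⁻-matching N⁻-covers

      N≡M⁺ : ∀ u v → N u v ≡ M⁺ u v
      N≡M⁺ u v = ⇔⇒≡ there back
        where
        there : N u v ≡ true → M⁺ u v ≡ true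
        there e with true-cases (pair a b u v)
        ... | inj₁ p = ∨-introʳ (M u v) p
        ... | inj₂ p = M⇒M⁺ (trans (≡-sym (N⁻≡M u v)) (∧-intro e (cong not p)))
        back : M⁺ u v ≡ true → N u v ≡ true
        back e with M⁺⇒ e
        ... | inj₁ p = N⁻⇒N (trans (N⁻≡M u v) p)
        ... | inj₂ (inj₁ (refl , refl)) = Nab
        ... | inj₂ (inj₂ (refl , refl)) = N-sym Nab

    M⁺-uniquelyRestricted : IsUniquelyRestricted G M⁺
    M⁺-uniquelyRestricted = M⁺-matching , N≡M⁺

    -- `size` sees only the increasing orientation of an edge, so a single new entry with `s` below
    -- `t` suffices; the order of `a` and `b` is decided in `size-M⁺`.
    size-suc : ∀ {s t} → toℕ s < toℕ t → M s t ≢ true → M⁺ s t ≡ true → suc (size M) ≤ size M⁺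
    size-suc {s} {t} s<t ∉M ∈M⁺ = begin
      suc (size M)                                           ≡⟨ cong suc (size≡sum M) ⟩
      1 + sum (λ u → ∣ edge M u ∣)                           ≡⟨ cong (_+ sum (λ u → ∣ edge M u ∣)) (≡-sym (trans (sum-cong-≗ λ u → ∣∧-singleton∣ (u == s) t) (∣singleton∣ s))) ⟩
      sum (λ u → ∣ new u ∣) + sum (λ u → ∣ edge M u ∣)        ≡⟨ ≡-sym (∑-distrib-+ (λ u → ∣ new u ∣) (λ u → ∣ edge M u ∣)) ⟩
      sum (λ u → ∣ new u ∣ + ∣ edge M u ∣)                    ≡⟨ sum-cong-≗ (λ u → ≡-sym (∑-distrib-+ (𝟙 ∘ new u) (𝟙 ∘ edge M u))) ⟩
      sum (λ u → sum (λ v → 𝟙 (new u v) + 𝟙 (edge M u v)))   ≤⟨ sum-mono-≤ (λ u → sum-mono-≤ (bound u)) ⟩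
      sum (λ u → ∣ edge M⁺ u ∣)                              ≡⟨ ≡-sym (size≡sum M⁺) ⟩
      size M⁺                                                ∎
      where
      open ≤-Reasoning
      edge : EdgeSet n → EdgeSet n
      edge F u v = (toℕ u <ᵇ toℕ v) ∧ F u v
      new : EdgeSet n
      new u v = (u == s) ∧ (v == t)
      bound : ∀ u v → 𝟙 (new u v) + 𝟙 (edge M u v) ≤ 𝟙 (edge M⁺ u v)
      bound u v with true-cases (new u v)
      ... | inj₂ p rewrite p = 𝟙-mono {edge M u v} λ e → ∧-intro (∧-conicalˡ _ _ e) (M⇒M⁺ (∧-conicalʳ (toℕ u <ᵇ toℕ v) _ e))
      ... | inj₁ p with refl ← ==⇒≡ {u = u} (∧-conicalˡ _ _ p) | refl ← ==⇒≡ {u = v} (∧-conicalʳ (u == s) _ p) = begin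
        𝟙 (new s t) + 𝟙 (edge M s t)  ≤⟨ +-mono-≤ {𝟙 (new s t)} {1} (𝟙-bound λ _ → ≤-refl) (𝟙-bound {edge M s t} {0} λ e → ⊥-elim (∉M (∧-conicalʳ (toℕ s <ᵇ toℕ t) _ e))) ⟩
        1                             ≤⟨ 𝟙-true (∧-intro (to T-≡ (<⇒<ᵇ s<t)) ∈M⁺) ⟩
        𝟙 (edge M⁺ s t)               ∎

    size-M⁺ : suc (size M) ≤ size M⁺
    size-M⁺ with <-cmp (toℕ a) (toℕ b)
    ... | tri< a<b _ _ = size-suc a<b (a∉ b) M⁺ab
    ... | tri≈ _ a≡b _ = ⊥-elim (adj⇒≢ ab (toℕ-injective a≡b))
    ... | tri> _ _ b<a = size-suc b<a (b∉ a) M⁺ba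

  -- Degrees into a vertex set and deletion of closed neighbourhoods

  deg : (Fin n → Bool) → Fin n → ℕ
  deg W v = ∣ (λ u → adj G v u ∧ W u) ∣

  del : (Fin n → Bool) → Fin n → Fin n → Bool
  del W a v = W v ∧ (not (v == a) ∧ not (adj G a v))

  nbrs : (Fin n → Bool) → Fin n → Fin n → Bool
  nbrs W a v = adj G a v ∧ W v

  del⇒ : ∀ {W a v} → del W a v ≡ true → W v ≡ true × v ≢ a × adj G a v ≡ false
  del⇒ {W} {a} {v} e with W v | v ≟ a | adj G a v
  ... | true | no v≢a | false = refl , v≢a , refl

  del-cases : ∀ {W a v} → W v ≡ true → v ≡ a ⊎ (nbrs W a v ≡ true ⊎ del W a v ≡ true)
  del-cases {W} {a} {v} e with W v | v ≟ a | adj G a v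
  ... | true | yes v≡a | _ = inj₁ v≡a
  ... | true | no v≢a | true = inj₂ (inj₁ refl)
  ... | true | no v≢a | false = inj₂ (inj₂ refl)

  del-a : ∀ {W a} → del W a a ≢ true
  del-a {W} {a} e = proj₁ (proj₂ (del⇒ {W} e)) refl

  ∣del∣< : ∀ {W a} → W a ≡ true → ∣ del W a ∣ < ∣ W ∣
  ∣del∣< {W} {a} Wa = ∣∣-insert {p = del W a} (del-a {W}) Wa λ v e → proj₁ (del⇒ {W} e)

  -- A matching supported in `del W a` covers neither `a` nor any neighbour of `a`, which is exactly
  -- what `AddEdge` asks for.
  good-step : ∀ {W a b k} → W a ≡ true → W b ≡ true → adj G a b ≡ true → Good (del W a) k → Good W (suc k)
  good-step {W} {a} {b} Wa Wb ab (M , ur , supp , sz) =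
    M⁺ , M⁺-uniquelyRestricted , supp⁺ , ≤-trans (s≤s sz) size-M⁺
    where
    open AddEdge ab M ur (λ v e → del-a {W} (supp a v e)) (λ u v e → proj₂ (proj₂ (del⇒ {W} (supp u v e))))
    supp⁺ : ∀ u v → M⁺ u v ≡ true → W u ≡ true
    supp⁺ u v e with M⁺⇒ e
    ... | inj₁ p = proj₁ (del⇒ {W} (supp u v p))
    ... | inj₂ (inj₁ (refl , _)) = Wa
    ... | inj₂ (inj₂ (refl , _)) = Wb

  -- Double counting: both sides count the ordered pairs in `S` × `T` that are adjacent.
  edges-swap : ∀ S T → sum (λ u → 𝟙 (S u) * deg T u) ≡ sum (λ v → 𝟙 (T v) * deg S v)
  edges-swap S T = begin
    sum (λ u → 𝟙 (S u) * deg T u)                               ≡⟨ sum-cong-≗ (λ u → *-distribˡ-sum (𝟙 (S u)) (𝟙 ∘ nbrs T u)) ⟩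
    sum (λ u → sum (λ v → 𝟙 (S u) * 𝟙 (nbrs T u v)))            ≡⟨ ∑-comm (λ u v → 𝟙 (S u) * 𝟙 (nbrs T u v)) ⟩
    sum (λ v → sum (λ u → 𝟙 (S u) * 𝟙 (nbrs T u v)))            ≡⟨ sum-cong-≗ (λ v → sum-cong-≗ (swap v)) ⟩
    sum (λ v → sum (λ u → 𝟙 (T v) * 𝟙 (nbrs S v u)))            ≡⟨ sum-cong-≗ (λ v → ≡-sym (*-distribˡ-sum (𝟙 (T v)) (𝟙 ∘ nbrs S v))) ⟩
    sum (λ v → 𝟙 (T v) * deg S v)                               ∎
    where
    open ≡-Reasoning
    swap : ∀ v u → 𝟙 (S u) * 𝟙 (nbrs T u v) ≡ 𝟙 (T v) * 𝟙 (nbrs S v u)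
    swap v u rewrite Graph.sym G u v with S u | T v | adj G v u
    ... | true | true | e = refl
    ... | true | false | true = refl
    ... | true | false | false = refl
    ... | false | true | true = refl
    ... | false | true | false = refl
    ... | false | false | e = refl

  -- Peeling off vertices of degree at most one

  -- B consists of the matched neighbours of the peeled vertices, L of the peeled
  -- vertices themselves.
  record Peeling (W : Fin n → Bool) : Set where
    field
      B L core : Fin n → Bool
      cover    : ∀ v → W v ≡ true → B v ≡ true ⊎ (L v ≡ true ⊎ core v ≡ true)
      L⊆       : ∀ v → L v ≡ true → W v ≡ true
      core⊆    : ∀ v → core v ≡ true → W v ≡ true
      core-deg : ∀ v → core v ≡ true → 2 ≤ deg core v
      L-nbrs   : ∀ l u → L l ≡ true → adj G l u ≡ true → W u ≡ true → B u ≡ true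
      extend   : ∀ k → Good core k → Good W (∣ B ∣ + k)

  good-≤ : ∀ {W k k′} → k ≤ k′ → Good W k′ → Good W k
  good-≤ k≤k′ (M , ur , supp , sz) = M , ur , supp , ≤-trans k≤k′ sz

  -- The bound `m` on `∣ W ∣` makes the recursion structural. Each round deletes the closed
  -- neighbourhood of some `a` with at most one alive neighbour.
  peel : ∀ m W → ∣ W ∣ ≤ m → Peeling W
  peel m W ∣W∣≤m with any? (λ v → (W v ≟ᵇ true) ×-dec (deg W v ≤? 1))
  peel m W ∣W∣≤m | no none = record
    { B = λ _ → false ; L = λ _ → false ; core = W
    ; cover = λ v e → inj₂ (inj₂ e)
    ; L⊆ = λ _ ()
    ; core⊆ = λ _ e → e
    ; core-deg = λ v e → ≰⇒> λ d → none (v , e , d)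
    ; L-nbrs = λ _ _ ()
    ; extend = λ k → good-≤ (+-monoˡ-≤ k (∣∣≤0 {n} {λ _ → false} λ _ ()))
    }
  peel zero W ∣W∣≤m | yes (a , Wa , d) = contradiction (≤-trans (∣del∣< {W} Wa) ∣W∣≤m) λ ()
  peel (suc m) W ∣W∣≤m | yes (a , Wa , d) = record
    { B = B⁺ ; L = L⁺ ; core = P.core
    ; cover = cover⁺
    ; L⊆ = λ v e → [ (λ p → proj₁ (del⇒ {W} (P.L⊆ v p))) , (λ p → subst (λ x → W x ≡ true) (≡-sym (==⇒≡ {u = v} p)) Wa) ]′ (∨-elim (P.L v) e)
    ; core⊆ = λ v e → proj₁ (del⇒ {W} (P.core⊆ v e))
    ; core-deg = P.core-deg
    ; L-nbrs = L-nbrs⁺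
    ; extend = λ k g → extend⁺ k (P.extend k g)
    }
    where
    module P = Peeling (peel m (del W a) (≤-pred (≤-trans (∣del∣< {W} Wa) ∣W∣≤m)))
    B⁺ L⁺ : Fin n → Bool
    B⁺ v = P.B v ∨ nbrs W a v
    L⁺ v = P.L v ∨ (v == a)
    cover⁺ : ∀ v → W v ≡ true → B⁺ v ≡ true ⊎ (L⁺ v ≡ true ⊎ P.core v ≡ true)
    cover⁺ v e with del-cases {W} {a} e
    ... | inj₁ refl = inj₂ (inj₁ (∨-introʳ (P.L v) (==-refl v)))
    ... | inj₂ (inj₁ p) = inj₁ (∨-introʳ (P.B v) p)
    ... | inj₂ (inj₂ p) with P.cover v p
    ...   | inj₁ q = inj₁ (∨-introˡ q)
    ...   | inj₂ (inj₁ q) = inj₂ (inj₁ (∨-introˡ q))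
    ...   | inj₂ (inj₂ q) = inj₂ (inj₂ q)
    -- An older `l` survived the deletion of `a`, so `a` is not its neighbour; a neighbour of `l` is
    -- then either adjacent to `a` or alive in the later rounds.
    L-nbrs⁺ : ∀ l u → L⁺ l ≡ true → adj G l u ≡ true → W u ≡ true → B⁺ u ≡ true
    L-nbrs⁺ l u e lu Wu with ∨-elim (P.L l) e
    ... | inj₂ p with refl ← ==⇒≡ {u = l} p = ∨-introʳ (P.B u) (∧-intro lu Wu)
    ... | inj₁ p with del-cases {W} {a} Wu
    ...   | inj₁ refl = ⊥-elim (true≢false (adj-sym lu) (proj₂ (proj₂ (del⇒ {W} (P.L⊆ l p)))))
    ...   | inj₂ (inj₁ q) = ∨-introʳ (P.B u) q
    ...   | inj₂ (inj₂ q) = ∨-introˡ (P.L-nbrs l u p lu q)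
    ∣B⁺∣≤ : ∣ B⁺ ∣ ≤ ∣ P.B ∣ + deg W a
    ∣B⁺∣≤ = ∣∣-cover P.B (nbrs W a) (λ v → ∨-elim (P.B v))
    extend⁺ : ∀ k → Good (del W a) (∣ P.B ∣ + k) → Good W (∣ B⁺ ∣ + k)
    extend⁺ k g with any? (λ b → nbrs W a b ≟ᵇ true)
    ... | yes (b , e) = good-≤ (+-monoˡ-≤ k (≤-trans ∣B⁺∣≤ (≤-trans (+-monoʳ-≤ ∣ P.B ∣ d) (≤-reflexive (+-comm ∣ P.B ∣ 1)))))
                               (good-step Wa (∧-conicalʳ (adj G a b) _ e) (∧-conicalˡ _ _ e) g)
    ... | no none = good-≤ (+-monoˡ-≤ k (≤-trans ∣B⁺∣≤ (≤-trans (+-monoʳ-≤ ∣ P.B ∣ (∣∣≤0 λ v e → none (v , e))) (≤-reflexive (+-identityʳ ∣ P.B ∣)))))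
                           (good-mono (λ v e → proj₁ (del⇒ {W} e)) g)

  -- Absence of 4-cycles and its effect on degrees

  C4-free : Set
  C4-free = ∀ a w x y → a ≢ w → x ≢ y → adj G a x ≡ true → adj G a y ≡ true → adj G w x ≡ true → adj G w y ≡ true → ⊥

  girth≥5⇒C4-free : GirthAtLeast G 5 → C4-free
  -- The cycle is `a`, `x`, `w`, `y`; the index 3 encodes length 4.
  girth≥5⇒C4-free girth a w x y a≢w x≢y ax ay wx wy = contradiction (girth 3 f (s≤s (s≤s (s≤s z≤n)) , inj , edges , adj-sym ay)) (<⇒≱ ≤-refl)
    where
    f : Fin 4 → Fin n
    f zero = a
    f (suc zero) = x
    f (suc (suc zero)) = w
    f (suc (suc (suc zero))) = y
    inj : ∀ {i j} → f i ≡ f j → i ≡ j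
    inj {zero} {zero} e = refl
    inj {zero} {suc zero} e = ⊥-elim (adj⇒≢ ax e)
    inj {zero} {suc (suc zero)} e = ⊥-elim (a≢w e)
    inj {zero} {suc (suc (suc zero))} e = ⊥-elim (adj⇒≢ ay e)
    inj {suc zero} {zero} e = ⊥-elim (adj⇒≢ ax (≡-sym e))
    inj {suc zero} {suc zero} e = refl
    inj {suc zero} {suc (suc zero)} e = ⊥-elim (adj⇒≢ wx (≡-sym e))
    inj {suc zero} {suc (suc (suc zero))} e = ⊥-elim (x≢y e)
    inj {suc (suc zero)} {zero} e = ⊥-elim (a≢w (≡-sym e))
    inj {suc (suc zero)} {suc zero} e = ⊥-elim (adj⇒≢ wx e)
    inj {suc (suc zero)} {suc (suc zero)} e = refl
    inj {suc (suc zero)} {suc (suc (suc zero))} e = ⊥-elim (adj⇒≢ wy e)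
    inj {suc (suc (suc zero))} {zero} e = ⊥-elim (adj⇒≢ ay (≡-sym e))
    inj {suc (suc (suc zero))} {suc zero} e = ⊥-elim (x≢y (≡-sym e))
    inj {suc (suc (suc zero))} {suc (suc zero)} e = ⊥-elim (adj⇒≢ wy (≡-sym e))
    inj {suc (suc (suc zero))} {suc (suc (suc zero))} e = refl
    edges : ∀ (i : Fin 3) → adj G (f (inject₁ i)) (f (suc i)) ≡ true
    edges zero = ax
    edges (suc zero) = adj-sym wx
    edges (suc (suc zero)) = wy

  -- Two common neighbours of `w` and `a` would close a 4-cycle.
  common-nbrs≤1 : C4-free → ∀ {W a w} → w ≢ a → deg (nbrs W a) w ≤ 1
  common-nbrs≤1 c4 {W} {a} {w} w≢a = ∣∣≤1 unique
    where
    common : Fin n → Bool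
    common u = adj G w u ∧ nbrs W a u
    w~ : ∀ u → common u ≡ true → adj G w u ≡ true
    w~ u = ∧-conicalˡ _ _
    a~ : ∀ u → common u ≡ true → adj G a u ≡ true
    a~ u e = ∧-conicalˡ (adj G a u) _ (∧-conicalʳ (adj G w u) _ e)
    unique : ∀ x y → common x ≡ true → common y ≡ true → x ≡ y
    unique x y p q with x ≟ y
    ... | yes x≡y = x≡y
    ... | no x≢y = ⊥-elim (c4 w a x y w≢a x≢y (w~ x p) (w~ y q) (a~ x p) (a~ y q))

  -- As `w` is not adjacent to `a`, each alive neighbour of `w` is in the neighbourhood of `a` or
  -- survives the deletion. `T` is later `B` for peeled vertices and `del W a` itself for surviving
  -- ones.
  deg-nbrs-del : ∀ {W a w} (T : Fin n → Bool) → adj G a w ≡ false → (∀ u → adj G w u ≡ true → del W a u ≡ true → T u ≡ true) →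
                 deg W w ≤ deg (nbrs W a) w + deg T w
  deg-nbrs-del {W} {a} {w} T a≁w h = ∣∣-cover (nbrs (nbrs W a) w) (nbrs T w) split
    where
    split : ∀ u → nbrs W w u ≡ true → nbrs (nbrs W a) w u ≡ true ⊎ nbrs T w u ≡ true
    split u e with ∧-conicalˡ (adj G w u) _ e
    ... | wu with del-cases {W} {a} (∧-conicalʳ (adj G w u) _ e)
    ...   | inj₁ refl = ⊥-elim (true≢false (adj-sym wu) a≁w)
    ...   | inj₂ (inj₁ p) = inj₁ (∧-intro wu p)
    ...   | inj₂ (inj₂ p) = inj₂ (∧-intro wu (h u wu p))

  -- Rooted spanning forests

  record RootedForest : Set where
    field
      nonroot     : Fin n → Bool
      parent      : Fin n → Fin n
      depth       : Fin n → ℕ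
      parent-adj  : ∀ v → nonroot v ≡ true → adj G v (parent v) ≡ true
      parent-depth : ∀ v → nonroot v ≡ true → depth (parent v) < depth v

    nonroots : (Fin n → Bool) → Fin n → Bool
    nonroots W v = W v ∧ nonroot v

    -- Climbing to parents stays inside `W` and lowers `depth`, so the climb stops, and it can stop
    -- only at a root.
    closed⇒root : (W : Fin n → Bool) → (∀ u v → W u ≡ true → adj G u v ≡ true → W v ≡ true) →
                  ∀ m v → depth v ≤ m → W v ≡ true → ∃ λ r → W r ≡ true × nonroot r ≡ false
    closed⇒root W closed m v d≤m Wv with true-cases (nonroot v)
    ... | inj₂ e = v , Wv , e
    closed⇒root W closed zero v d≤m Wv | inj₁ e = contradiction (≤-trans (parent-depth v e) d≤m) λ ()
    closed⇒root W closed (suc m) v d≤m Wv | inj₁ e =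
      closed⇒root W closed m (parent v) (≤-pred (≤-trans (parent-depth v e) d≤m)) (closed v (parent v) Wv (parent-adj v e))

  -- Constructing the matching and counting nonroots

  module Bounded (Δ : ℕ) (4≤Δ : 4 ≤ Δ) (maxdeg : MaxDegreeAtMost G Δ) (c4 : C4-free) (F : RootedForest) where
    open RootedForest F

    degree≤Δ : ∀ v → ∣ adj G v ∣ ≤ Δ
    degree≤Δ v = ≤-trans (≤-reflexive (≡-sym (countV≡∣∣ (adj G v)))) (maxdeg v)

    deg≤Δ : ∀ W v → deg W v ≤ Δ
    deg≤Δ W v = ≤-trans (∣∣-mono {p = nbrs W v} λ u → ∧-conicalˡ _ _) (degree≤Δ v)

    missing⇒deg<Δ : ∀ {W v u} → adj G v u ≡ true → W u ≢ true → deg W v < Δ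
    missing⇒deg<Δ {W} {v} {u} vu Wu = ≤-trans (∣∣-insert {p = nbrs W v} (λ e → Wu (∧-conicalʳ (adj G v u) _ e)) vu (λ _ → ∧-conicalˡ _ _)) (degree≤Δ v)

    -- The vertex `a` costs nothing when it is a root; this saved unit pays for deleting a vertex of
    -- full degree `Δ`.
    nonroots-del : ∀ {W a} → ∣ nonroots W ∣ ≤ 𝟙 (nonroot a) + (deg W a + ∣ nonroots (del W a) ∣)
    nonroots-del {W} {a} = begin
      ∣ nonroots W ∣                                                           ≤⟨ ∣∣-cover is-a rest split ⟩
      ∣ is-a ∣ + ∣ rest ∣                                                      ≡⟨ cong (_+ ∣ rest ∣) (∣∧-singleton∣ (nonroot a) a) ⟩
      𝟙 (nonroot a) + ∣ rest ∣                                                 ≤⟨ +-monoʳ-≤ (𝟙 (nonroot a)) (∣∣-cover (nbrs W a) (nonroots (del W a)) (λ v → ∨-elim (nbrs W a v))) ⟩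
      𝟙 (nonroot a) + (deg W a + ∣ nonroots (del W a) ∣)                       ∎
      where
      open ≤-Reasoning
      is-a rest : Fin n → Bool
      is-a v = nonroot a ∧ (v == a)
      rest v = nbrs W a v ∨ nonroots (del W a) v
      split : ∀ v → nonroots W v ≡ true → is-a v ≡ true ⊎ rest v ≡ true
      split v e with del-cases {W} {a} (∧-conicalˡ (W v) _ e)
      ... | inj₁ refl = inj₁ (∧-intro (∧-conicalʳ (W v) _ e) (==-refl v))
      ... | inj₂ (inj₁ p) = inj₂ (∨-introˡ p)
      ... | inj₂ (inj₂ p) = inj₂ (∨-introʳ (nbrs W a v) (∧-intro p (∧-conicalʳ (W v) _ e)))

    good-step-deg : ∀ {W a k} → W a ≡ true → 1 ≤ deg W a → Good (del W a) k → Good W (suc k)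
    good-step-deg {W} {a} Wa d g with ∣∣≥1⇒∃ (nbrs W a) d
    ... | b , e = good-step Wa (∧-conicalʳ (adj G a b) _ e) (∧-conicalˡ _ _ e) g

    -- Edges from `L` are counted into `B` and into the two neighbours of `a`; `2-edge-count`
    -- combines the two estimates.
    peel-count : ∀ {W a} → (∀ v → W v ≡ true → 2 ≤ deg W v) → W a ≡ true → deg W a ≡ 2 → (P : Peeling (del W a)) →
                 3 + (∣ Peeling.B P ∣ + ∣ Peeling.L P ∣) ≤ Δ + Δ * ∣ Peeling.B P ∣
    peel-count {W} {a} W-deg Wa d P = 2-edge-count Δ ∣ B ∣ ∣ L ∣ 4≤Δ ∣L∣≤ 2∣L∣≤
      where
      open Peeling P
      open ≤-Reasoning
      N : Fin n → Bool
      N = nbrs W a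
      L-deg : ∀ l → L l ≡ true → 2 ≤ deg N l + deg B l
      L-deg l e with del⇒ {W} {a} (L⊆ l e)
      ... | Wl , _ , a≁l = ≤-trans (W-deg l Wl) (deg-nbrs-del B a≁l (λ u lu p → L-nbrs l u e lu p))
      L-degB : ∀ l → L l ≡ true → 1 ≤ deg B l
      L-degB l e = ≤-pred (≤-trans (L-deg l e) (+-monoˡ-≤ (deg B l) (common-nbrs≤1 c4 {W} (proj₁ (proj₂ (del⇒ {W} (L⊆ l e)))))))
      eLB : ℕ
      eLB = sum (λ l → 𝟙 (L l) * deg B l)
      eLB≤ : eLB ≤ Δ * ∣ B ∣
      eLB≤ = begin
        eLB                               ≡⟨ edges-swap L B ⟩
        sum (λ b → 𝟙 (B b) * deg L b)     ≤⟨ weighted≤ B (λ b _ → deg≤Δ L b) ⟩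
        Δ * ∣ B ∣                         ∎
      ∣L∣≤ : ∣ L ∣ ≤ Δ * ∣ B ∣
      ∣L∣≤ = begin
        ∣ L ∣      ≡⟨ ≡-sym (*-identityˡ ∣ L ∣) ⟩
        1 * ∣ L ∣  ≤⟨ weighted≥ L L-degB ⟩
        eLB        ≤⟨ eLB≤ ⟩
        Δ * ∣ B ∣  ∎
      eLN : ℕ
      eLN = sum (λ l → 𝟙 (L l) * deg N l)
      -- One edge at `x` goes to `a`, which is deleted and so lies outside `L`.
      N-deg : ∀ x → N x ≡ true → 1 + deg L x ≤ Δ
      N-deg x e = missing⇒deg<Δ {L} (adj-sym (∧-conicalˡ _ _ e)) (λ p → del-a {W} (L⊆ a p))
      eLN≤ : eLN + 2 ≤ Δ * 2
      eLN≤ = begin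
        -- The summand 2 is `∣ N ∣`, spread as one unit over each neighbour of `a`.
        eLN + 2                                             ≡⟨ cong₂ _+_ (edges-swap L N) (≡-sym d) ⟩
        sum (λ x → 𝟙 (N x) * deg L x) + ∣ N ∣               ≡⟨ ≡-sym (∑-distrib-+ (λ x → 𝟙 (N x) * deg L x) (𝟙 ∘ N)) ⟩
        sum (λ x → 𝟙 (N x) * deg L x + 𝟙 (N x))             ≡⟨ sum-cong-≗ (λ x → trans (+-comm (𝟙 (N x) * deg L x) (𝟙 (N x))) (≡-sym (*-suc (𝟙 (N x)) (deg L x)))) ⟩
        sum (λ x → 𝟙 (N x) * suc (deg L x))                 ≤⟨ weighted≤ N N-deg ⟩
        Δ * ∣ N ∣                                           ≡⟨ cong (Δ *_) d ⟩
        Δ * 2                                               ∎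
      2∣L∣≤ : 2 * ∣ L ∣ + 2 ≤ Δ * 2 + Δ * ∣ B ∣
      2∣L∣≤ = begin
        2 * ∣ L ∣ + 2                                       ≤⟨ +-monoˡ-≤ 2 (weighted≥ L L-deg) ⟩
        sum (λ l → 𝟙 (L l) * (deg N l + deg B l)) + 2       ≡⟨ cong (_+ 2) (sum-cong-≗ (λ l → *-distribˡ-+ (𝟙 (L l)) (deg N l) (deg B l))) ⟩
        sum (λ l → 𝟙 (L l) * deg N l + 𝟙 (L l) * deg B l) + 2  ≡⟨ cong (_+ 2) (∑-distrib-+ (λ l → 𝟙 (L l) * deg N l) (λ l → 𝟙 (L l) * deg B l)) ⟩
        eLN + eLB + 2                                       ≡⟨ trans (+-assoc eLN eLB 2) (trans (cong (eLN +_) (+-comm eLB 2)) (≡-sym (+-assoc eLN 2 eLB))) ⟩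
        eLN + 2 + eLB                                       ≤⟨ +-mono-≤ eLN≤ eLB≤ ⟩
        Δ * 2 + Δ * ∣ B ∣                                   ∎

    nonroots-peel : ∀ {W} (P : Peeling W) → let open Peeling P in
                    ∣ nonroots W ∣ ≤ ∣ nonroots (λ v → B v ∨ L v) ∣ + ∣ nonroots core ∣
    nonroots-peel {W} P = ∣∣-cover (nonroots (λ v → B v ∨ L v)) (nonroots core) split
      where
      open Peeling P
      split : ∀ v → nonroots W v ≡ true → nonroots (λ v → B v ∨ L v) v ≡ true ⊎ nonroots core v ≡ true
      split v e with ∧-conicalʳ (W v) _ e | cover v (∧-conicalˡ (W v) _ e)
      ... | nr | inj₁ p = inj₁ (∧-intro (∨-introˡ p) nr)
      ... | nr | inj₂ (inj₁ p) = inj₁ (∧-intro (∨-introʳ (B v) p) nr)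
      ... | nr | inj₂ (inj₂ p) = inj₂ (∧-intro p nr)

    -- Minimum degree 2 is the invariant. It is restored by peeling after a vertex of degree 2 is
    -- used, and survives by itself when all degrees are at least 3.
    core-matching : ∀ m W → ∣ W ∣ ≤ m → (∀ v → W v ≡ true → 2 ≤ deg W v) → ∃ λ k → Good W k × ∣ nonroots W ∣ ≤ Δ * k
    core-matching m W ∣W∣≤m W-deg with any? (λ v → W v ≟ᵇ true)
    core-matching m W ∣W∣≤m W-deg | no none = 0 , good-∅ W , ≤-trans (∣∣≤0 {p = nonroots W} λ v e → none (v , ∧-conicalˡ _ _ e)) z≤n
    core-matching zero W ∣W∣≤m W-deg | yes (w , Ww) = contradiction (≤-trans (∣∣≥1 {p = W} Ww) ∣W∣≤m) λ ()
    core-matching (suc m) W ∣W∣≤m W-deg | yes (w , Ww)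
      with any? (λ v → (W v ≟ᵇ true) ×-dec (deg W v ≤? 2)) | any? (λ v → (W v ≟ᵇ true) ×-dec (deg W v <? Δ))
    ... | yes (a , Wa , d≤2) | _ = case₂
      where
      P : Peeling (del W a)
      P = peel m (del W a) (≤-pred (≤-trans (∣del∣< {W} Wa) ∣W∣≤m))
      open Peeling P
      open ≤-Reasoning
      d : deg W a ≡ 2
      d = ≤-antisym d≤2 (W-deg a Wa)
      count : ∀ k → ∣ nonroots core ∣ ≤ Δ * k → ∣ nonroots W ∣ ≤ Δ * suc (∣ B ∣ + k)
      count k h = begin
        ∣ nonroots W ∣                                                     ≤⟨ nonroots-del {W} {a} ⟩
        𝟙 (nonroot a) + (deg W a + ∣ nonroots (del W a) ∣)                 ≤⟨ +-monoˡ-≤ _ (𝟙-bound {nonroot a} {1} λ _ → ≤-refl) ⟩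
        1 + (deg W a + ∣ nonroots (del W a) ∣)                             ≤⟨ s≤s (+-mono-≤ d≤2 (nonroots-peel P)) ⟩
        -- The 3 counts `a`, taken as a nonroot at worst, and its two neighbours.
        3 + (∣ nonroots (λ v → B v ∨ L v) ∣ + ∣ nonroots core ∣)           ≤⟨ +-monoʳ-≤ 3 (+-mono-≤ (∣∣-cover B L (λ v e → ∨-elim (B v) (∧-conicalˡ _ _ e))) h) ⟩
        3 + (∣ B ∣ + ∣ L ∣ + Δ * k)                                        ≡⟨ ≡-sym (+-assoc 3 (∣ B ∣ + ∣ L ∣) (Δ * k)) ⟩
        3 + (∣ B ∣ + ∣ L ∣) + Δ * k                                        ≤⟨ +-monoˡ-≤ (Δ * k) (peel-count {W} W-deg Wa d P) ⟩
        Δ + Δ * ∣ B ∣ + Δ * k                                              ≡⟨ distrib Δ ∣ B ∣ k ⟩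
        Δ * suc (∣ B ∣ + k)                                                ∎
        where
        distrib : ∀ Δ b k → Δ + Δ * b + Δ * k ≡ Δ * suc (b + k)
        distrib = solve-∀
      ∣core∣≤m : ∣ core ∣ ≤ m
      ∣core∣≤m = ≤-trans (∣∣-mono core⊆) (≤-pred (≤-trans (∣del∣< {W} Wa) ∣W∣≤m))
      case₂ : ∃ λ k → Good W k × ∣ nonroots W ∣ ≤ Δ * k
      case₂ with core-matching m core ∣core∣≤m core-deg
      ... | k , g , h = suc (∣ B ∣ + k) , good-step-deg Wa (≤-trans (n≤1+n 1) (W-deg a Wa)) (extend k g) , count k h
    ... | no none≤2 | small = case₃ small
      where
      open ≤-Reasoning
      3≤deg : ∀ v → W v ≡ true → 3 ≤ deg W v
      3≤deg v e = ≰⇒> λ d → none≤2 (v , e , d)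
      delete : ∀ a → W a ≡ true → 𝟙 (nonroot a) + deg W a ≤ Δ → ∃ λ k → Good W k × ∣ nonroots W ∣ ≤ Δ * k
      delete a Wa few with core-matching m (del W a) (≤-pred (≤-trans (∣del∣< {W} Wa) ∣W∣≤m)) del-deg
        where
        -- Of at least three alive neighbours, at most one is lost to the neighbourhood of `a`.
        del-deg : ∀ v → del W a v ≡ true → 2 ≤ deg (del W a) v
        del-deg v e with del⇒ {W} e
        ... | Wv , v≢a , a≁v = ≤-pred (≤-trans (3≤deg v Wv) (≤-trans (deg-nbrs-del (del W a) a≁v (λ _ _ p → p))
                                 (+-monoˡ-≤ (deg (del W a) v) (common-nbrs≤1 c4 {W} v≢a))))
      ... | k , g , h = suc k , good-step-deg Wa (≤-trans (s≤s z≤n) (3≤deg a Wa)) g , (begin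
        ∣ nonroots W ∣                                          ≤⟨ nonroots-del {W} {a} ⟩
        𝟙 (nonroot a) + (deg W a + ∣ nonroots (del W a) ∣)      ≡⟨ ≡-sym (+-assoc (𝟙 (nonroot a)) (deg W a) ∣ nonroots (del W a) ∣) ⟩
        𝟙 (nonroot a) + deg W a + ∣ nonroots (del W a) ∣        ≤⟨ +-mono-≤ few h ⟩
        Δ + Δ * k                                               ≡⟨ ≡-sym (*-suc Δ k) ⟩
        Δ * suc k                                               ∎)
      case₃ : Dec (∃ λ v → W v ≡ true × deg W v < Δ) → ∃ λ k → Good W k × ∣ nonroots W ∣ ≤ Δ * k
      case₃ (yes (a , Wa , d<Δ)) = delete a Wa (≤-trans (+-monoˡ-≤ (deg W a) (𝟙-bound {nonroot a} {1} λ _ → ≤-refl)) d<Δ)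
      -- Every vertex of `W` has all `Δ` of its possible neighbours alive, so no edge leaves `W` and
      -- a root can be found inside it.
      case₃ (no none<Δ) with closed⇒root W closed (depth w) w ≤-refl Ww
        where
        closed : ∀ u v → W u ≡ true → adj G u v ≡ true → W v ≡ true
        closed u v Wu uv with true-cases (W v)
        ... | inj₁ e = e
        ... | inj₂ e = ⊥-elim (none<Δ (u , Wu , missing⇒deg<Δ {W} uv (λ p → true≢false p e)))
      ... | r , Wr , root = delete r Wr (subst (λ x → 𝟙 x + deg W r ≤ Δ) (≡-sym root) (deg≤Δ W r))

    -- A nonroot b ∈ B pays with (b , parent b), a nonroot l ∈ L with (parent l , l);
    -- depths show that no pair in B × V is used twice.
    charge : (B L : Fin n → Bool) → (∀ l u → L l ≡ true → adj G l u ≡ true → B u ≡ true) →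
             ∣ nonroots (λ v → B v ∨ L v) ∣ ≤ Δ * ∣ B ∣
    charge B L L-nbrs = begin
      ∣ nonroots (λ v → B v ∨ L v) ∣                          ≤⟨ ∣∣-cover (nonroots B) (nonroots L) split ⟩
      -- Each nonroot is replaced by the pair it forms with its parent.
      ∣ nonroots B ∣ + ∣ nonroots L ∣                         ≡⟨ cong₂ _+_ (sum-cong-≗ λ b → ≡-sym (∣∧-singleton∣ (nonroots B b) (parent b))) (sum-cong-≗ λ l → ≡-sym (∣∧-singleton∣ (nonroots L l) (parent l))) ⟩
      -- The pairs from `L` are transposed, so that the outer index is now the end in `B` for both
      -- kinds.
      sum (λ b → ∣ up B b ∣) + sum (λ l → ∣ up L l ∣)         ≡⟨ cong (sum (λ b → ∣ up B b ∣) +_) (∑-comm (λ l b → 𝟙 (up L l b))) ⟩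
      sum (λ b → ∣ up B b ∣) + sum (λ b → sum (λ l → 𝟙 (up L l b)))  ≡⟨ ≡-sym (∑-distrib-+ (λ b → ∣ up B b ∣) (λ b → sum (λ l → 𝟙 (up L l b)))) ⟩
      sum (λ b → ∣ up B b ∣ + sum (λ l → 𝟙 (up L l b)))       ≡⟨ sum-cong-≗ (λ b → ≡-sym (∑-distrib-+ (𝟙 ∘ up B b) (λ l → 𝟙 (up L l b)))) ⟩
      sum (λ b → sum (λ u → 𝟙 (up B b u) + 𝟙 (up L u b)))     ≤⟨ sum-mono-≤ (λ b → sum-mono-≤ (bound b)) ⟩
      sum (λ b → sum (λ u → 𝟙 (B b) * 𝟙 (adj G b u)))         ≡⟨ sum-cong-≗ (λ b → ≡-sym (*-distribˡ-sum (𝟙 (B b)) (𝟙 ∘ adj G b))) ⟩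
      sum (λ b → 𝟙 (B b) * ∣ adj G b ∣)                       ≤⟨ weighted≤ B (λ b _ → degree≤Δ b) ⟩
      Δ * ∣ B ∣                                               ∎
      where
      open ≤-Reasoning
      up : (Fin n → Bool) → Fin n → Fin n → Bool
      up S v u = nonroots S v ∧ (u == parent v)
      split : ∀ v → nonroots (λ v → B v ∨ L v) v ≡ true → nonroots B v ≡ true ⊎ nonroots L v ≡ true
      split v e with ∧-conicalʳ (B v ∨ L v) _ e | ∨-elim (B v) (∧-conicalˡ _ _ e)
      ... | nr | inj₁ p = inj₁ (∧-intro p nr)
      ... | nr | inj₂ p = inj₂ (∧-intro p nr)
      up⇒ : ∀ S v u → up S v u ≡ true → S v ≡ true × nonroot v ≡ true × u ≡ parent v
      up⇒ S v u e = ∧-conicalˡ (S v) _ (∧-conicalˡ (nonroots S v) _ e) , ∧-conicalʳ (S v) _ (∧-conicalˡ (nonroots S v) _ e) , ==⇒≡ {u = u} (∧-conicalʳ (nonroots S v) _ e)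
      edge≥1 : ∀ {b u} → B b ≡ true → adj G b u ≡ true → 1 ≤ 𝟙 (B b) * 𝟙 (adj G b u)
      edge≥1 {b} {u} p q = *-mono-≤ (𝟙-true p) (𝟙-true q)
      bound : ∀ b u → 𝟙 (up B b u) + 𝟙 (up L u b) ≤ 𝟙 (B b) * 𝟙 (adj G b u)
      bound b u with true-cases (up B b u) | true-cases (up L u b)
      ... | inj₂ p | inj₂ q rewrite p | q = z≤n
      ... | inj₁ p | inj₂ q rewrite p | q with up⇒ B b u p
      ...   | Bb , nr , refl = edge≥1 Bb (parent-adj b nr)
      bound b u | inj₂ p | inj₁ q rewrite p | q with up⇒ L u b q
      ...   | Lu , nr , refl = edge≥1 (L-nbrs u _ Lu (parent-adj u nr)) (adj-sym (parent-adj u nr))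
      -- Here `b` and `u` would each be the parent of the other.
      bound b u | inj₁ p | inj₁ q with up⇒ B b u p | up⇒ L u b q
      ...   | _ , nr , refl | _ , nr′ , e = ⊥-elim (<-asym (parent-depth b nr) (subst (λ x → depth x < depth u) (≡-sym e) (parent-depth u nr′)))

    forest-matching : ∃ λ k → Good (λ _ → true) k × ∣ nonroot ∣ ≤ Δ * k
    forest-matching with P ← peel _ (λ _ → true) ≤-refl with core-matching _ (Peeling.core P) ≤-refl (Peeling.core-deg P)
    ... | k , g , h = ∣ B ∣ + k , extend k g , (begin
      ∣ nonroot ∣                                                    ≤⟨ nonroots-peel P ⟩
      -- The first peeling starts from all vertices, so `L-nbrs` speaks of every neighbour in `G`,
      -- as `charge` demands.
      ∣ nonroots (λ v → B v ∨ L v) ∣ + ∣ nonroots (Peeling.core P) ∣  ≤⟨ +-mono-≤ (charge B L (λ l u e lu → L-nbrs l u e lu refl)) h ⟩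
      Δ * ∣ B ∣ + Δ * k                                              ≡⟨ ≡-sym (*-distribˡ-+ Δ ∣ B ∣ k) ⟩
      Δ * (∣ B ∣ + k)                                                ∎)
      where
      open Peeling P
      open ≤-Reasoning

-- A shortest-path forest from the components

least : {P : ℕ → Set} → Decidable P → ∀ k → P k → ∃ λ m → P m × (∀ j → P j → m ≤ j)
least P? k Pk with P? 0
... | yes P0 = 0 , P0 , λ _ _ → z≤n
least P? zero Pk | no ¬P0 = contradiction Pk ¬P0
least {P} P? (suc k) Pk | no ¬P0 with least (P? ∘ suc) k Pk
... | m , Pm , min = suc m , Pm , min′
  where
  min′ : ∀ j → P j → suc m ≤ j
  min′ zero P0 = contradiction P0 ¬P0
  min′ (suc j) Pj = s≤s (min j Pj)

module _ (G : Graph n) where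

  -- Indexing by length makes existence decidable by finite search, so that `least` can select a
  -- shortest walk.
  Walk : Fin n → ℕ → Fin n → Set
  Walk r zero v = v ≡ r
  Walk r (suc k) v = ∃ λ w → adj G v w ≡ true × Walk r k w

  walk? : ∀ r v → Decidable (λ k → Walk r k v)
  walk? r v zero = v ≟ r
  walk? r v (suc k) = any? λ w → (adj G v w ≟ᵇ true) ×-dec walk? r w k

  reachable⇒walk : ∀ {v r} → Reachable G v r → ∃ λ k → Walk r k v
  reachable⇒walk ε = 0 , refl
  reachable⇒walk (e ◅ p) with reachable⇒walk p
  ... | k , q = suc k , _ , e , q

  module Components {c : ℕ} (hc : HasComponents G c) where

    comp : Fin n → Fin c
    comp = proj₁ hc

    rep : Fin c → Fin n
    rep i = proj₁ (proj₁ (proj₂ hc) i)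

    root : Fin n → Fin n
    root v = rep (comp v)

    reachable-root : ∀ v → Reachable G v (root v)
    reachable-root v = to (proj₂ (proj₂ hc) v (root v)) (≡-sym (proj₂ (proj₁ (proj₂ hc) (comp v)) refl))

    adj⇒root≡ : ∀ {v w} → adj G v w ≡ true → root v ≡ root w
    adj⇒root≡ {v} {w} e = cong rep (from (proj₂ (proj₂ hc) v w) (e ◅ ε))

    shortest : ∀ v → ∃ λ m → Walk (root v) m v × (∀ j → Walk (root v) j v → m ≤ j)
    shortest v with reachable⇒walk (reachable-root v)
    ... | k , p = least (walk? (root v) v) k p

    depth : Fin n → ℕ
    depth v = proj₁ (shortest v)

    nonroot : Fin n → Bool
    nonroot v = not (v == root v)

    -- The parent is the second vertex of a shortest walk from `v` to its root. It has the same
    -- root, and the rest of the walk bounds its depth.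
    parent-spec : ∀ v → ∃ λ w → nonroot v ≡ true → adj G v w ≡ true × depth w < depth v
    parent-spec v with shortest v
    ... | zero , v≡root , _ = v , λ nr → contradiction (trans (≡-sym nr) (cong not (trans (cong (_== root v) v≡root) (==-refl (root v))))) λ ()
    ... | suc m , (w , vw , p) , _ = w , λ _ → vw , s≤s (proj₂ (proj₂ (shortest w)) m (subst (λ r → Walk r m w) (adj⇒root≡ vw) p))

    forest : RootedForest G
    forest = record
      { nonroot = nonroot
      ; parent = proj₁ ∘ parent-spec
      ; depth = depth
      ; parent-adj = λ v e → proj₁ (proj₂ (parent-spec v) e)
      ; parent-depth = λ v e → proj₂ (proj₂ (parent-spec v) e)
      }

    -- Every root is the representative of its own component, so the roots are dominated by the
    -- pairs of a vertex and a component it represents, one for each component.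
    ∣roots∣≤c : ∣ (λ v → v == root v) ∣ ≤ c
    ∣roots∣≤c = begin
      ∣ (λ v → v == root v) ∣                     ≤⟨ sum-mono-≤ (λ v → 𝟙-bound λ e → ∣∣≥1 {p = λ i → v == rep i} e) ⟩
      sum (λ v → ∣ (λ i → v == rep i) ∣)          ≡⟨ ∑-comm (λ v i → 𝟙 (v == rep i)) ⟩
      sum (λ i → ∣ _== rep i ∣)                   ≡⟨ sum-cong-≗ (λ i → ∣singleton∣ (rep i)) ⟩
      sum {c} (λ _ → 1)                           ≡⟨ sum-ones c ⟩
      c                                           ∎
      where open ≤-Reasoning

    n∸c≤∣nonroot∣ : n ∸ c ≤ ∣ nonroot ∣
    n∸c≤∣nonroot∣ = m≤n+o⇒m∸n≤o n c (begin
      n                                           ≡⟨ ≡-sym (sum-ones n) ⟩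
      ∣ (λ (_ : Fin n) → true) ∣                  ≤⟨ ∣∣-cover (λ v → v == root v) nonroot (λ v _ → split (v == root v)) ⟩
      ∣ (λ v → v == root v) ∣ + ∣ nonroot ∣       ≤⟨ +-monoˡ-≤ ∣ nonroot ∣ ∣roots∣≤c ⟩
      c + ∣ nonroot ∣                             ∎)
      where
      open ≤-Reasoning
      split : ∀ b → b ≡ true ⊎ not b ≡ true
      split true = inj₁ refl
      split false = inj₂ refl

-- The lower bound for uniquely restricted matchings

theorem3 : (Δ : ℕ) → 4 ≤ Δ → (n : ℕ) → (G : Graph n) → MaxDegreeAtMost G Δ → GirthAtLeast G 5 → (c : ℕ) → HasComponents G c → Σ (EdgeSet n) (λ M → IsUniquelyRestricted G M × (n ∸ c ≤ Δ * size M))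
theorem3 Δ 4≤Δ n G maxdeg girth c hc
  with Bounded.forest-matching G Δ 4≤Δ maxdeg (girth≥5⇒C4-free G girth) (Components.forest G hc)
... | k , (M , ur , _ , k≤size) , h =
  M , ur , ≤-trans (Components.n∸c≤∣nonroot∣ G hc) (≤-trans h (*-monoʳ-≤ Δ k≤size))
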